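{- Let $n\ge4$ and let $x\in B$ with $|x|=2n+4$ and $\delta(x)=4$. Then $[x]_2\notin R$.
   Context: Stern's sequence $(a(n))_{n\ge0}$: $a(0)=0$, $a(1)=1$, $a(2n)=a(n)$, $a(2n+1)=a(n)+a(n+1)$; $s(n)=a(n+1)$. $R$ is the set of record-setters of $s$, i.e. indices $v\ge0$ with $s(i)<s(v)$ for all $i<v$. For a binary string $x$, $[x]_2$ is the integer it represents in base 2 and $|x|$ its length. $B$ denotes the set of nonempty binary strings that are concatenations of blocks each equal to $10$ or $100$; for $x\in B$, $\delta(x)$ is the number of $0$s minus the number of $1$s in $x$, which equals the number of $100$ blocks. -}

module Defs where

open import Data.Digit using (Bit; 0b; 1b; fromDigits)
open import Data.Fin.Properties using (_≟_)
open import Data.Integer.Base using (ℤ; +_; _-_)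
open import Data.List.Base using (List; []; _∷_; concat; filter; length; reverse)
open import Data.List.Relation.Unary.All using (All)
open import Data.Nat.Base using (ℕ; zero; suc; _+_; _*_; _≤_; _<_; s≤s; ⌊_/2⌋; parity)
open import Data.Nat.Properties using (*-suc; +-comm; ≤-refl; ≤-trans; n≤1+n; ⌊n/2⌋≤n)
open import Data.Parity.Base using (0ℙ; 1ℙ)
open import Data.Product.Base using (∃-syntax; _×_)
open import Data.Sum.Base using (_⊎_)
open import Relation.Binary.PropositionalEquality using (_≡_; _≢_; refl; trans; cong; cong₂)

-- The first argument is fuel; n units suffice for index n (see fuel-irrelevant).
-- That a satisfies the defining recurrences of Stern's sequence is
-- a-even and a-odd below.
stern : ℕ → ℕ → ℕ
stern zero    _ = 0
stern (suc f) 0 = 0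
stern (suc f) 1 = 1
stern (suc f) n@(suc (suc _)) with parity n
... | 0ℙ = stern f ⌊ n /2⌋
... | 1ℙ = stern f ⌊ n /2⌋ + stern f (suc ⌊ n /2⌋)

a : ℕ → ℕ
a n = stern n n

s : ℕ → ℕ
s n = a (suc n)

RecordSetter : ℕ → Set
RecordSetter v = ∀ i → i < v → s i < s v

BinaryString : Set
BinaryString = List Bit

-- Strings are written most significant digit first, whereas fromDigits
-- expects the least significant digit first.
[_]₂ : BinaryString → ℕ
[ x ]₂ = fromDigits (reverse x)

IsBlock : BinaryString → Set
IsBlock w = w ≡ 1b ∷ 0b ∷ [] ⊎ w ≡ 1b ∷ 0b ∷ 0b ∷ []

B : BinaryString → Set
B x = x ≢ [] × ∃[ ws ] (All IsBlock ws × x ≡ concat ws)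

occurrences : Bit → BinaryString → ℕ
occurrences b x = length (filter (_≟ b) x)

δ : BinaryString → ℤ
δ x = + occurrences 0b x - + occurrences 1b x

private
  half-bound : ∀ k {f} → suc k ≤ f → suc ⌊ k /2⌋ ≤ f
  half-bound k k<f = ≤-trans (s≤s (⌊n/2⌋≤n k)) k<f

  odd-half-bound : ∀ k {f} → parity k ≡ 1ℙ → suc k ≤ f → suc (suc ⌊ k /2⌋) ≤ f
  odd-half-bound (suc zero)    _ k<f       = k<f
  odd-half-bound (suc (suc k)) p (s≤s k<f) = s≤s (odd-half-bound k p (≤-trans (n≤1+n (suc k)) k<f))

  parity-2* : ∀ n → parity (2 * n) ≡ 0ℙ
  parity-2* zero    = refl
  parity-2* (suc n) = trans (cong parity (*-suc 2 n)) (parity-2* n)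

  parity-1+2* : ∀ n → parity (suc (2 * n)) ≡ 1ℙ
  parity-1+2* zero    = refl
  parity-1+2* (suc n) = trans (cong (λ m → parity (suc m)) (*-suc 2 n)) (parity-1+2* n)

  ⌊2*n/2⌋ : ∀ n → ⌊ 2 * n /2⌋ ≡ n
  ⌊2*n/2⌋ zero    = refl
  ⌊2*n/2⌋ (suc n) = trans (cong ⌊_/2⌋ (*-suc 2 n)) (cong suc (⌊2*n/2⌋ n))

  ⌊1+2*n/2⌋ : ∀ n → ⌊ suc (2 * n) /2⌋ ≡ n
  ⌊1+2*n/2⌋ zero    = refl
  ⌊1+2*n/2⌋ (suc n) = trans (cong (λ m → ⌊ suc m /2⌋) (*-suc 2 n)) (cong suc (⌊1+2*n/2⌋ n))

fuel-irrelevant : ∀ f g n → n ≤ f → n ≤ g → stern f n ≡ stern g n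
fuel-irrelevant zero    zero    zero _ _ = refl
fuel-irrelevant zero    (suc g) zero _ _ = refl
fuel-irrelevant (suc f) zero    zero _ _ = refl
fuel-irrelevant (suc f) (suc g) zero _ _ = refl
fuel-irrelevant (suc f) (suc g) (suc zero) _ _ = refl
fuel-irrelevant (suc f) (suc g) (suc (suc k)) (s≤s p) (s≤s q) with parity k in eq
... | 0ℙ = fuel-irrelevant f g _ (half-bound k p) (half-bound k q)
... | 1ℙ = cong₂ _+_
  (fuel-irrelevant f g _ (half-bound k p) (half-bound k q))
  (fuel-irrelevant f g _ (odd-half-bound k eq p) (odd-half-bound k eq q))

private
  unfold-even : ∀ k → parity k ≡ 0ℙ → a (suc (suc k)) ≡ a (suc ⌊ k /2⌋)
  unfold-even k eq with parity k
  unfold-even k refl | 0ℙ = fuel-irrelevant _ _ _ (half-bound k ≤-refl) ≤-refl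

  unfold-odd : ∀ k → parity k ≡ 1ℙ → a (suc (suc k)) ≡ a (suc ⌊ k /2⌋) + a (suc (suc ⌊ k /2⌋))
  unfold-odd k eq with parity k | odd-half-bound k {suc k}
  unfold-odd k refl | 1ℙ | bound = cong₂ _+_
    (fuel-irrelevant _ _ _ (half-bound k ≤-refl) ≤-refl)
    (fuel-irrelevant _ _ _ (bound refl ≤-refl) ≤-refl)

a-even : ∀ n → a (2 * n) ≡ a n
a-even zero    = refl
a-even (suc n) = trans (cong a (*-suc 2 n))
  (trans (unfold-even (2 * n) (parity-2* n)) (cong (λ m → a (suc m)) (⌊2*n/2⌋ n)))

a-odd : ∀ n → a (2 * n + 1) ≡ a n + a (n + 1)
a-odd n rewrite +-comm (2 * n) 1 | +-comm n 1 = odd n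
  where
  odd : ∀ n → a (suc (2 * n)) ≡ a n + a (suc n)
  odd zero    = refl
  odd (suc n) = trans (cong (λ m → a (suc m)) (*-suc 2 n))
    (trans (unfold-odd (suc (2 * n)) (parity-1+2* n))
           (cong (λ m → a (suc m) + a (suc (suc m))) (⌊1+2*n/2⌋ n)))

{-# OPTIONS --safe #-}
-- Reading a binary digit acts linearly on the vector (a(v), a(v+1)).  With Q
-- the Fibonacci matrix (fib below), the block 10 acts as Q², so (10)^k with
-- k ≥ 1 is a nonnegative combination of Q² and Q³.  To compare x, with four
-- blocks 100 and r blocks 10, to a competitor y(10)^r, distribute the powers of
-- Q² on the right in the same way as they occur in x (they commute): by linearity
-- each maximal run of blocks 10 may then be replaced by one of I, Q², Q³ on both
-- sides, which leaves finitely many numerical inequalities.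
-- The competitor is 1000(10)^n if x starts with 100100, and 100100(10)^(n-1)
-- otherwise.
module Submission where

open import Defs
open import Algebra.Properties.CommutativeSemigroup using (interchange)
open import Data.Digit using (Bit; 0b; 1b; fromDigits)
open import Data.Fin.Base as Fin using (toℕ)
open import Data.Fin.Properties using (toℕ≤pred[n])
open import Data.Integer.Base using (+_; _-_)
open import Data.Integer.Properties using (m-n≡m⊖n; ⊖-≥; +-injective)
open import Data.List.Base using ([]; _∷_; length; concat; foldl; _ʳ++_)
open import Data.List.Relation.Unary.All using (All; []; _∷_)
open import Data.Nat.Base using (ℕ; zero; suc; _+_; _*_; _∸_; _≤_; _<_; s≤s)
open import Data.Nat.Properties using (_≤?_; ≤-refl; ≤-trans; <-irrefl; <-≤-trans; +-mono-≤; +-comm; +-suc; *-comm; *-monoˡ-≤; m≤n+m; m+n∸n≡m; +-commutativeSemigroup)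
open import Data.Product.Base using (_×_; _,_; proj₂; ∃₂; ∃-syntax)
open import Data.Sum.Base using (inj₁; inj₂)
open import Function.Base using (_∘_)
open import Relation.Binary.Core using (Rel)
open import Relation.Binary.Definitions using (Decidable)
open import Relation.Binary.PropositionalEquality using (_≡_; refl; sym; trans; cong; cong₂; subst; subst₂)
open import Relation.Nullary.Decidable using (_×-dec_; from-yes)
open import Relation.Nullary.Negation using (¬_)
open import Level using (0ℓ)

-- Binary digits acting linearly on Stern pairs

Vector : Set
Vector = ℕ × ℕ

infixl 6 _⊕_

_⊕_ : Vector → Vector → Vector
(p , q) ⊕ (p′ , q′) = p + p′ , q + q′

Additive : (Vector → Vector) → Set
Additive f = ∀ u v → f (u ⊕ v) ≡ f u ⊕ f v

∘-additive : ∀ {f g} → Additive f → Additive g → Additive (f ∘ g)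
∘-additive {f} {g} f-add g-add u v = trans (cong f (g-add u v)) (f-add (g u) (g v))

appendBit : Bit → Vector → Vector
appendBit Fin.zero (p , q) = p , p + q
appendBit (Fin.suc Fin.zero) (p , q) = p + q , q

appendBit-additive : ∀ b → Additive (appendBit b)
appendBit-additive Fin.zero (p , q) (p′ , q′) = cong (p + p′ ,_) (interchange +-commutativeSemigroup p p′ q q′)
appendBit-additive (Fin.suc Fin.zero) (p , q) (p′ , q′) = cong (_, q + q′) (interchange +-commutativeSemigroup p p′ q q′)

append10 append100 fib : Vector → Vector
append10  = appendBit 0b ∘ appendBit 1b
append100 = appendBit 0b ∘ append10
fib (p , q) = q , p + q

append10-additive : Additive append10
append10-additive = ∘-additive {appendBit 0b} {appendBit 1b} (appendBit-additive 0b) (appendBit-additive 1b)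

append100-additive : Additive append100
append100-additive = ∘-additive {appendBit 0b} {append10} (appendBit-additive 0b) append10-additive

fib-additive : Additive fib
fib-additive (p , q) (p′ , q′) = cong (q + q′ ,_) (interchange +-commutativeSemigroup p p′ q q′)

-- Cayley-Hamilton for the Fibonacci matrix: Q² = I + Q.
append10-split : ∀ u → append10 u ≡ u ⊕ fib u
append10-split (p , q) = cong (p + q ,_) (+-comm (p + q) q)

fib-append10-split : ∀ u → fib (append10 u) ≡ fib u ⊕ append10 u
fib-append10-split (p , q) = cong (_, p + q + (p + q + q)) (+-comm (p + q) q)

append10² : ∀ u → append10 (append10 u) ≡ append10 u ⊕ append10 (fib u)
append10² u = trans (cong append10 (append10-split u)) (append10-additive u (fib u))

-- Q⁵ = Q³ + Q⁴, with Q⁴ expanded once more so that only Q² and Q³ remain.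
append10-fib-append10 : ∀ u → append10 (fib (append10 u)) ≡ append10 (fib u) ⊕ (append10 u ⊕ append10 (fib u))
append10-fib-append10 u = trans (cong append10 (fib-append10-split u))
  (trans (append10-additive (fib u) (append10 u)) (cong (append10 (fib u) ⊕_) (append10² u)))

-- Comparisons preserved by runs of blocks 10

AdditiveRel : Rel Vector 0ℓ → Set
AdditiveRel R = ∀ {u v u′ v′} → R u v → R u′ v′ → R (u ⊕ u′) (v ⊕ v′)

-- The components apply I, Q² and Q³ to both sides: I stands for an empty run of blocks 10, the
-- other two generate every nonempty run.
□ : Rel Vector 0ℓ → Rel Vector 0ℓ
□ R u v = R u v × R (append10 u) (append10 v) × R (append10 (fib u)) (append10 (fib v))

□-additive : ∀ {R} → AdditiveRel R → AdditiveRel (□ R)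
□-additive {R} R-add {u} {v} {u′} {v′} (r₀ , r₂ , r₃) (r₀′ , r₂′ , r₃′) =
  R-add r₀ r₀′ ,
  subst₂ R (sym (append10-additive u u′)) (sym (append10-additive v v′)) (R-add r₂ r₂′) ,
  subst₂ R (sym (add₃ u u′)) (sym (add₃ v v′)) (R-add r₃ r₃′)
  where
  add₃ : Additive (append10 ∘ fib)
  add₃ = ∘-additive {append10} {fib} append10-additive fib-additive

-- Q⁴ and Q⁵ are nonnegative combinations of Q² and Q³, so the last two components alone yield all
-- three after one more block 10.
□-append10 : ∀ {R} → AdditiveRel R → ∀ {u v} → □ R u v → □ R (append10 u) (append10 v)
□-append10 {R} R-add {u} {v} (_ , r₂ , r₃) =
  r₂ ,
  subst₂ R (sym (append10² u)) (sym (append10² v)) (R-add r₂ r₃) ,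
  subst₂ R (sym (append10-fib-append10 u)) (sym (append10-fib-append10 v)) (R-add r₃ (R-add r₂ r₃))

□? : ∀ {R} → Decidable R → Decidable (□ R)
□? R? u v = R? u v ×-dec R? (append10 u) (append10 v) ×-dec R? (append10 (fib u)) (append10 (fib v))

-- The index counts the blocks 100 still to be read on the left-hand side.
Dominated : ℕ → Rel Vector 0ℓ
Base : ℕ → Rel Vector 0ℓ
Dominated d = □ (Base d)
Base zero    u v = proj₂ u ≤ proj₂ v
Base (suc d) u v = Dominated d (append100 u) v

base-additive : ∀ d → AdditiveRel (Base d)
base-additive zero    = +-mono-≤
base-additive (suc d) {u} {v} {u′} {v′} r r′ =
  subst (λ w → Dominated d w (v ⊕ v′)) (sym (append100-additive u u′))
    (□-additive {Base d} (base-additive d) r r′)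

base? : ∀ d → Decidable (Base d)
base? zero    u v = proj₂ u ≤? proj₂ v
base? (suc d) u v = □? (base? d) (append100 u) v

dominated? : ∀ d → Decidable (Dominated d)
dominated? d = □? (base? d)

-- Words in the blocks 10 and 100

data Word : ℕ → ℕ → BinaryString → Set where
  []    : Word 0 0 []
  10∷_  : ∀ {d r x} → Word d r x → Word d (suc r) (1b ∷ 0b ∷ x)
  100∷_ : ∀ {d r x} → Word d r x → Word (suc d) r (1b ∷ 0b ∷ 0b ∷ x)

appendBits : Vector → BinaryString → Vector
appendBits = foldl (λ u b → appendBit b u)

10^ : ℕ → BinaryString
10^ zero    = []
10^ (suc r) = 1b ∷ 0b ∷ 10^ r

-- A block 10 is read on both sides at once, a block 100 on the left only; both sides hold r blocks
-- 10, so they end together.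
dominated⇒≤ : ∀ {d r x u v} → Word d r x → Dominated d u v →
  proj₂ (appendBits u x) ≤ proj₂ (appendBits v (10^ r))
dominated⇒≤ []       (u≤v , _) = u≤v
dominated⇒≤ {d} (10∷ w) dom    = dominated⇒≤ w (□-append10 {Base d} (base-additive d) dom)
-- A block 100 ends the current run, so the component for I applies.
dominated⇒≤ (100∷ w) (dom , _) = dominated⇒≤ w dom

blocks⇒word : ∀ {ws} → All IsBlock ws → ∃₂ λ d r → Word d r (concat ws)
blocks⇒word [] = 0 , 0 , []
blocks⇒word (inj₁ refl ∷ bs) = let d , r , w = blocks⇒word bs in d , suc r , 10∷ w
blocks⇒word (inj₂ refl ∷ bs) = let d , r , w = blocks⇒word bs in suc d , r , 100∷ w

word-occurrences : ∀ {d r x} → Word d r x → occurrences 0b x ≡ d + occurrences 1b x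
word-occurrences [] = refl
word-occurrences {d} {x = _ ∷ _ ∷ x} (10∷ w) =
  trans (cong suc (word-occurrences w)) (sym (+-suc d (occurrences 1b x)))
word-occurrences {suc d} {x = _ ∷ _ ∷ _ ∷ x} (100∷ w) =
  cong suc (trans (cong suc (word-occurrences w)) (sym (+-suc d (occurrences 1b x))))

word-δ : ∀ {d r x} → Word d r x → δ x ≡ + d
word-δ {d} {x = x} w = trans (cong (λ m → + m - + o) (word-occurrences w))
  (trans (m-n≡m⊖n (d + o) o) (trans (⊖-≥ (m≤n+m o d)) (cong +_ (m+n∸n≡m d o))))
  where o = occurrences 1b x

length-10^ : ∀ r → length (10^ r) ≡ r * 2
length-10^ zero    = refl
length-10^ (suc r) = cong (suc ∘ suc) (length-10^ r)

word-length : ∀ {d r x} → Word d r x → length x ≡ d * 3 + r * 2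
word-length [] = refl
word-length {d} {suc r} (10∷ w) = trans (cong (suc ∘ suc) (word-length w))
  (sym (trans (+-suc (d * 3) (suc (r * 2))) (cong suc (+-suc (d * 3) (r * 2)))))
word-length (100∷ w) = cong (suc ∘ suc ∘ suc) (word-length w)

-- Values and Stern pairs of binary strings

appendDigit : ℕ → Bit → ℕ
appendDigit v b = toℕ b + v * 2

appendDigits : ℕ → BinaryString → ℕ
appendDigits = foldl appendDigit

-- Generalised over the accumulator of `reverse`, which holds the digits already read.
fromDigits-ʳ++ : ∀ x y → fromDigits (x ʳ++ y) ≡ appendDigits (fromDigits y) x
fromDigits-ʳ++ []      y = refl
fromDigits-ʳ++ (b ∷ x) y = fromDigits-ʳ++ x (b ∷ y)

[]₂-appendDigits : ∀ x → [ x ]₂ ≡ appendDigits 0 x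
[]₂-appendDigits x = fromDigits-ʳ++ x []

-- A digit is at most 1, so b + 2v < 2(v + 1) ≤ 2v′: the gap between the prefixes survives each
-- step.
appendDigits-< : ∀ {v v′} x y → length x ≡ length y → v < v′ → appendDigits v x < appendDigits v′ y
appendDigits-< []      []       _  v<v′ = v<v′
appendDigits-< {v} {v′} (b ∷ x) (b′ ∷ y) eq v<v′ = appendDigits-< x y (cong (_∸ 1) eq)
  (≤-trans (s≤s (+-mono-≤ (toℕ≤pred[n] b) ≤-refl))
    (≤-trans (*-monoˡ-≤ 2 v<v′) (m≤n+m (v′ * 2) (toℕ b′))))

sternVector : ℕ → Vector
sternVector v = a v , s v

a-*2 : ∀ v → a (v * 2) ≡ a v
a-*2 v = trans (cong a (*-comm v 2)) (a-even v)

a-1+*2 : ∀ v → a (suc (v * 2)) ≡ a v + a (suc v)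
a-1+*2 v = trans (cong a (trans (+-comm 1 (v * 2)) (cong (_+ 1) (*-comm v 2))))
  (trans (a-odd v) (cong (λ w → a v + a w) (+-comm v 1)))

sternVector-appendDigit : ∀ v b → sternVector (appendDigit v b) ≡ appendBit b (sternVector v)
sternVector-appendDigit v Fin.zero = cong₂ _,_ (a-*2 v) (a-1+*2 v)
sternVector-appendDigit v (Fin.suc Fin.zero) = cong₂ _,_ (a-1+*2 v) (a-*2 (suc v))

sternVector-appendDigits : ∀ v x → sternVector (appendDigits v x) ≡ appendBits (sternVector v) x
sternVector-appendDigits v []      = refl
sternVector-appendDigits v (b ∷ x) = trans (sternVector-appendDigits (appendDigit v b) x)
  (cong (λ u → appendBits u x) (sternVector-appendDigit v b))

-- The starting pair (0 , 1) is (a(0), a(1)), belonging to the empty string.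
s-[]₂ : ∀ x → s [ x ]₂ ≡ proj₂ (appendBits (0 , 1) x)
s-[]₂ x = trans (cong s ([]₂-appendDigits x)) (cong proj₂ (sternVector-appendDigits 0 x))

¬recordSetter : ∀ x y → appendDigits 0 y < appendDigits 0 x →
  proj₂ (appendBits (0 , 1) x) ≤ proj₂ (appendBits (0 , 1) y) → ¬ RecordSetter [ x ]₂
¬recordSetter x y y<x sx≤sy record-x = <-irrefl refl (<-≤-trans
  (record-x [ y ]₂ (subst₂ _<_ (sym ([]₂-appendDigits y)) (sym ([]₂-appendDigits x)) y<x))
  (subst₂ _≤_ (sym (s-[]₂ x)) (sym (s-[]₂ y)) sx≤sy))

-- The competitors and the case distinction

100100++_ 1000++_ : BinaryString → BinaryString
100100++ y = 1b ∷ 0b ∷ 0b ∷ 1b ∷ 0b ∷ 0b ∷ y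
1000++ y   = 1b ∷ 0b ∷ 0b ∷ 0b ∷ y

-- Three extra blocks 10 make the lengths equal. Four blocks 100 leave five gaps for runs, hence 3⁵
-- inequalities, decided by evaluation.
≤-100100[10]^ : ∀ {r x} → Word 4 r x →
  proj₂ (appendBits (0 , 1) x) ≤ proj₂ (appendBits (0 , 1) (100100++ 10^ (3 + r)))
≤-100100[10]^ w = dominated⇒≤ w
  (from-yes (dominated? 4 (0 , 1) (appendBits (0 , 1) (100100++ 10^ 3))))

-- With the prefix 100100 already read, two blocks 100 and three gaps remain: 3³ inequalities.
≤-1000[10]^ : ∀ {r x} → Word 2 r x →
  proj₂ (appendBits (0 , 1) (100100++ x)) ≤ proj₂ (appendBits (0 , 1) (1000++ 10^ (4 + r)))
≤-1000[10]^ w = dominated⇒≤ w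
  (from-yes (dominated? 2 (appendBits (0 , 1) (100100++ [])) (appendBits (0 , 1) (1000++ 10^ 4))))

-- Supplies the digit 1 by which x exceeds the competitor 100100(10)^(n-1).
word-head : ∀ {d r x} → Word (suc d) r x → ∃[ y ] x ≡ 1b ∷ y
word-head (10∷ _)  = _ , refl
word-head (100∷ _) = _ , refl

word-¬recordSetter : ∀ {r x} → Word 4 r x → ¬ RecordSetter [ x ]₂
word-¬recordSetter w₀@(10∷_ {r = r} w) with word-head w
... | y , refl = ¬recordSetter (1b ∷ 0b ∷ 1b ∷ y) (100100++ 10^ (4 + r))
  -- The values of the prefixes 100 and 101.
  (appendDigits-< {4} {5} (1b ∷ 0b ∷ 0b ∷ 10^ (4 + r)) y
    (trans (cong (suc ∘ suc ∘ suc) (length-10^ (4 + r))) (sym (cong (_∸ 1) (word-length w)))) ≤-refl)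
  (≤-100100[10]^ w₀)
word-¬recordSetter w₀@(100∷ (10∷_ {r = r} w)) with word-head w
... | y , refl = ¬recordSetter (1b ∷ 0b ∷ 0b ∷ 1b ∷ 0b ∷ 1b ∷ y) (100100++ 10^ (4 + r))
  -- The values of the prefixes 100100 and 100101.
  (appendDigits-< {36} {37} (10^ (4 + r)) y
    (trans (length-10^ (4 + r)) (sym (cong (_∸ 1) (word-length w)))) ≤-refl)
  (≤-100100[10]^ w₀)
word-¬recordSetter (100∷ (100∷_ {r = r} {x = x} w)) = ¬recordSetter (100100++ x) (1000++ 10^ (4 + r))
  -- The values of the prefixes 1000 and 1001.
  (appendDigits-< {8} {9} (10^ (4 + r)) (0b ∷ 0b ∷ x)
    (trans (length-10^ (4 + r)) (sym (cong (suc ∘ suc) (word-length w)))) ≤-refl)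
  (≤-1000[10]^ w)

mainTheorem13 : (n : ℕ) → 4 ≤ n → (x : BinaryString) → B x → length x ≡ 2 * n + 4 → δ x ≡ + 4 → ¬ RecordSetter [ x ]₂
mainTheorem13 n _ x (_ , ws , blocks , refl) _ δx≡4 with blocks⇒word blocks
... | d , r , w with +-injective (trans (sym (word-δ w)) δx≡4)
... | refl = word-¬recordSetter w
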